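{- Let $1<k\le v$ be integers and let $C_{v,k}$ be the complete design. (a) $C_{v,k}$ is a $\mathrm{Sym}(v)$-pairwise transitive $2$-design if and only if $k=2$, $k=v-1$, or $k=v$. (b) $C_{v,k}$ is non-trivial and $G$-pairwise transitive if and only if $k=v-1\ge3$ and $G$ is a $2$-transitive subgroup of $\mathrm{Aut}(C_{v,k})=\mathrm{Sym}(v)$. Moreover $C_{v,v-1}$ is a symmetric $2$-design.
   Context: A design $\mathcal D=(\mathcal P,\mathcal B,\mathcal I)$ consists of finite sets $\mathcal P$ (points), $\mathcal B$ (blocks) and an incidence relation $\mathcal I\subseteq\mathcal P\times\mathcal B$. It is a $2$-$(v,k,\lambda)$ design (or $2$-design) if $|\mathcal P|=v$, each block is incident with exactly $k$ points, and each pair of distinct points is incident with exactly $\lambda$ common blocks. It is non-trivial if $2<k<v$, and symmetric if $|\mathcal B|=v$. The complete design $C_{v,k}$ ($1<k\le v$) has $v$ points and, for each $k$-subset $S$ of points, exactly one block whose set of incident points is $S$. An automorphism is a permutation of $\mathcal P\cup\mathcal B$ leaving $\mathcal P$ and $\mathcal B$ invariant setwise and preserving incidence; $\mathrm{Aut}(\mathcal D)$ is the group of all automorphisms, and $\mathrm{Aut}(C_{v,k})$ is identified with $\mathrm{Sym}(v)$ via its action on points. Two blocks are intersecting if some point is incident with both. For $G\le\mathrm{Aut}(\mathcal D)$, the $2$-design $\mathcal D$ is $G$-pairwise transitive if $G$ is transitive on each of the following five (possibly empty) sets of ordered pairs: pairs of distinct points, incident point-block pairs, non-incident point-block pairs,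 pairs of distinct intersecting blocks, pairs of non-intersecting blocks. -}

module Defs where

open import Algebra.Bundles using (Group)
open import Algebra.Morphism.Structures using (module GroupMorphisms)
open import Data.Fin.Base using (Fin)
open import Data.Fin.Properties using (+↔⊎)
open import Data.Fin.Subset using (Subset; ∣_∣; inside; outside) renaming (_∈_ to _∈ₛ_)
open import Data.Nat.Base using (ℕ; zero; suc; _<_; z≤n)
open import Data.Nat.Combinatorics using (_C_; nCk≡nC[n∸k]; nCn≡1; nCk+nC[k+1]≡[n+1]C[k+1])
open import Data.Nat.Properties using (≡-irrelevant; suc-injective)
open import Data.Product.Base using (Σ-syntax; ∃; _×_; _,_; proj₁; proj₂)
open import Data.Sum.Base using (_⊎_; inj₁; inj₂)
open import Data.Sum.Function.Propositional using (_⊎-↔_)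
open import Data.Unit.Base using (⊤)
open import Data.Vec.Base using ([]; _∷_)
open import Data.Vec.Properties.WithK using ([]=-irrelevant)
open import Function.Bundles using (_↔_; _⇔_; Inverse; mk↔ₛ′; mk⇔; module Equivalence)
open import Function.Construct.Composition using (_↔-∘_; _⇔-∘_)
open import Function.Construct.Identity using (↔-id; ⇔-id)
open import Function.Construct.Symmetry using (↔-sym)
open import Level using (0ℓ)
open import Relation.Binary.Core using (REL)
open import Relation.Binary.Definitions using (Irrelevant)
open import Relation.Binary.PropositionalEquality using (_≡_; _≢_; refl; sym; trans; cong; subst; subst₂)
open import Relation.Nullary.Negation using (¬_)
open import Relation.Unary using (Pred; _∈_)

HasSize : Set → ℕ → Set
HasSize A n = A ↔ Fin n

-- Incidence is proof-irrelevant so that it is a genuine subset of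
-- Point × Block; otherwise the sizes in Is2-vkλ-Design below would count
-- incidence proofs rather than points and blocks.
record Design : Set₁ where
  infix 4 _I_
  field
    Point          : Set
    Block          : Set
    _I_            : REL Point Block 0ℓ
    I-irrelevant   : Irrelevant _I_
    point-finite   : ∃ (HasSize Point)
    block-finite   : ∃ (HasSize Block)

module _ (D : Design) where
  open Design D

  record Is2-vkλ-Design (v k lam : ℕ) : Set where
    field
      points      : HasSize Point v
      blockSize   : ∀ B → HasSize (∃ λ p → p I B) k
      pairDegree  : ∀ p q → p ≢ q → HasSize (∃ λ B → p I B × q I B) lam

  Is2Design : Set
  Is2Design = ∃ λ v → ∃ λ k → ∃ λ lam → Is2-vkλ-Design v k lam

  IsNonTrivial2Design : Set
  IsNonTrivial2Design =
    ∃ λ v → ∃ λ k → ∃ λ lam → Is2-vkλ-Design v k lam × 2 < k × k < v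

  IsSymmetric2Design : Set
  IsSymmetric2Design =
    ∃ λ v → ∃ λ k → ∃ λ lam → Is2-vkλ-Design v k lam × HasSize Block v

  Intersecting : REL Block Block 0ℓ
  Intersecting B C = ∃ λ p → p I B × p I C

-- Permutations are compared by their action; (σ ∙ τ) x = σ (τ x).
Sym : Set → Group 0ℓ 0ℓ
Sym A = record
  { Carrier = A ↔ A
  ; _≈_     = λ σ τ → ∀ x → to σ x ≡ to τ x
  ; _∙_     = _↔-∘_
  ; ε       = ↔-id A
  ; _⁻¹     = ↔-sym
  ; isGroup = record
    { isMonoid = record
      { isSemigroup = record
        { isMagma = record
          { isEquivalence = record
            { refl  = λ _ → refl
            ; sym   = λ e x → sym (e x)
            ; trans = λ e f x → trans (e x) (f x)
            }
          ; ∙-cong = λ {σ} {σ′} {τ} {τ′} e f x → trans (e (to τ x)) (cong (to σ′) (f x))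
          }
        ; assoc = λ _ _ _ _ → refl
        }
      ; identity = (λ _ _ → refl) , (λ _ _ → refl)
      }
    ; inverse = (λ σ → strictlyInverseʳ σ) , (λ σ → strictlyInverseˡ σ)
    ; ⁻¹-cong = λ {σ} {τ} e x →
        trans (cong (from σ) (sym (trans (e (from τ x)) (strictlyInverseˡ τ x))))
              (strictlyInverseʳ σ (from τ x))
    }
  }
  where open Inverse

-- A permutation of the disjoint union Point ∪ Block leaving both parts
-- invariant is the same thing as a permutation of each part.
record Automorphism (D : Design) : Set where
  open Design D
  field
    onPoints  : Point ↔ Point
    onBlocks  : Block ↔ Block
    preserves : ∀ p B → p I B ⇔ Inverse.to onPoints p I Inverse.to onBlocks B

  actP : Point → Point
  actP = Inverse.to onPoints

  actB : Block → Block
  actB = Inverse.to onBlocks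

open Automorphism public using (onPoints)

Aut : Design → Group 0ℓ 0ℓ
Aut D = record
  { Carrier = Automorphism D
  ; _≈_     = λ α β → (onPoints α P.≈ onPoints β) × (onBlocks α B.≈ onBlocks β)
  ; _∙_     = λ α β → record
    { onPoints  = onPoints α P.∙ onPoints β
    ; onBlocks  = onBlocks α B.∙ onBlocks β
    ; preserves = λ p b → preserves α (actP β p) (actB β b) ⇔-∘ preserves β p b
    }
  ; ε       = record
    { onPoints  = P.ε
    ; onBlocks  = B.ε
    ; preserves = λ p b → ⇔-id (p I b)
    }
  ; _⁻¹     = λ α → record
    { onPoints  = onPoints α P.⁻¹
    ; onBlocks  = onBlocks α B.⁻¹
    ; preserves = λ p b →
        let pre = preserves α (from (onPoints α) p) (from (onBlocks α) b)
            ep  = strictlyInverseˡ (onPoints α) p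
            eb  = strictlyInverseˡ (onBlocks α) b
        in mk⇔ (λ i → Equivalence.from pre (subst₂ _I_ (sym ep) (sym eb) i))
               (λ i → subst₂ _I_ ep eb (Equivalence.to pre i))
    }
  ; isGroup = record
    { isMonoid = record
      { isSemigroup = record
        { isMagma = record
          { isEquivalence = record
            { refl  = (λ _ → refl) , (λ _ → refl)
            ; sym   = λ (e , f) → (λ x → sym (e x)) , (λ x → sym (f x))
            ; trans = λ (e , f) (e′ , f′) → (λ x → trans (e x) (e′ x)) , (λ x → trans (f x) (f′ x))
            }
          ; ∙-cong = λ {α} {α′} {β} {β′} (e , f) (e′ , f′) →
              P.∙-cong {onPoints α} {onPoints α′} {onPoints β} {onPoints β′} e e′ ,
              B.∙-cong {onBlocks α} {onBlocks α′} {onBlocks β} {onBlocks β′} f f′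
          }
        ; assoc = λ _ _ _ → (λ _ → refl) , (λ _ → refl)
        }
      ; identity = (λ _ → (λ _ → refl) , (λ _ → refl)) , (λ _ → (λ _ → refl) , (λ _ → refl))
      }
    ; inverse = (λ α → P.inverseˡ (onPoints α) , B.inverseˡ (onBlocks α))
              , (λ α → P.inverseʳ (onPoints α) , B.inverseʳ (onBlocks α))
    ; ⁻¹-cong = λ {α} {β} (e , f) →
        P.⁻¹-cong {onPoints α} {onPoints β} e , B.⁻¹-cong {onBlocks α} {onBlocks β} f
    }
  }
  where
  open Design D
  open Automorphism
  open Inverse
  module P = Group (Sym Point)
  module B = Group (Sym Block)

record Subgroup (G : Group 0ℓ 0ℓ) : Set₁ where
  open Group G
  field
    Member    : Pred Carrier 0ℓ
    respects  : ∀ {x y} → x ≈ y → x ∈ Member → y ∈ Member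
    ε-closed  : ε ∈ Member
    ∙-closed  : ∀ {x y} → x ∈ Member → y ∈ Member → x ∙ y ∈ Member
    ⁻¹-closed : ∀ {x} → x ∈ Member → x ⁻¹ ∈ Member

open Subgroup public using (Member)

whole : (G : Group 0ℓ 0ℓ) → Subgroup G
whole G = record
  { Member    = λ _ → ⊤
  ; respects  = λ _ _ → _
  ; ε-closed  = _
  ; ∙-closed  = λ _ _ → _
  ; ⁻¹-closed = λ _ → _
  }

-- The group of automorphisms whose action on points lies in H.
viaPoints : (D : Design) → Subgroup (Sym (Design.Point D)) → Subgroup (Aut D)
viaPoints D H = record
  { Member    = λ α → onPoints α ∈ Member H
  ; respects  = λ (e , _) → Subgroup.respects H e
  ; ε-closed  = Subgroup.ε-closed H
  ; ∙-closed  = Subgroup.∙-closed H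
  ; ⁻¹-closed = Subgroup.⁻¹-closed H
  }

module _ (D : Design) (G : Subgroup (Aut D)) where
  open Design D
  open Automorphism using (actP; actB)

  -- Transitivity on the set of ordered pairs (x , y) with R x y (vacuous
  -- when that set is empty).
  TransitiveOnPairs : {X Y : Set} → (Automorphism D → X → X) → (Automorphism D → Y → Y) →
                      REL X Y 0ℓ → Set
  TransitiveOnPairs _·ˣ_ _·ʸ_ R =
    ∀ {x y x′ y′} → R x y → R x′ y′ → ∃ λ α → α ∈ Member G × α ·ˣ x ≡ x′ × α ·ʸ y ≡ y′

  TwoTransitive : Set
  TwoTransitive = TransitiveOnPairs actP actP (λ p q → p ≢ q)

  record PairwiseTransitive : Set where
    field
      distinctPoints       : TransitiveOnPairs actP actP (λ p q → p ≢ q)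
      incident             : TransitiveOnPairs actP actB (λ p B → p I B)
      nonIncident          : TransitiveOnPairs actP actB (λ p B → ¬ p I B)
      distinctIntersecting : TransitiveOnPairs actB actB (λ B C → B ≢ C × Intersecting D B C)
      nonIntersecting      : TransitiveOnPairs actB actB (λ B C → ¬ Intersecting D B C)

KSubset : ℕ → ℕ → Set
KSubset v k = Σ[ S ∈ Subset v ] ∣ S ∣ ≡ k

private
  ext : ∀ {v k} {S T : KSubset v k} → proj₁ S ≡ proj₁ T → S ≡ T
  ext {S = S , p} {T = .S , q} refl = cong (S ,_) (≡-irrelevant p q)

  splitZero : ∀ {v} → KSubset (suc v) 0 ↔ KSubset v 0
  splitZero = mk↔ₛ′ f (λ (S , e) → outside ∷ S , e) (λ _ → refl) g
    where
    f : ∀ {v} → KSubset (suc v) 0 → KSubset v 0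
    f (outside ∷ S , e) = S , e
    g : ∀ {v} (S : KSubset (suc v) 0) → (outside ∷ proj₁ (f S) , proj₂ (f S)) ≡ S
    g (outside ∷ S , e) = refl

  splitSuc : ∀ {v k} → KSubset (suc v) (suc k) ↔ (KSubset v k ⊎ KSubset v (suc k))
  splitSuc = mk↔ₛ′ f g fg gf
    where
    f : ∀ {v k} → KSubset (suc v) (suc k) → KSubset v k ⊎ KSubset v (suc k)
    f (inside  ∷ S , e) = inj₁ (S , suc-injective e)
    f (outside ∷ S , e) = inj₂ (S , e)
    g : ∀ {v k} → KSubset v k ⊎ KSubset v (suc k) → KSubset (suc v) (suc k)
    g (inj₁ (S , e)) = inside ∷ S , cong suc e
    g (inj₂ (S , e)) = outside ∷ S , e
    fg : ∀ {v k} (x : KSubset v k ⊎ KSubset v (suc k)) → f (g x) ≡ x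
    fg (inj₁ S) = cong inj₁ (ext refl)
    fg (inj₂ S) = refl
    gf : ∀ {v k} (S : KSubset (suc v) (suc k)) → g (f S) ≡ S
    gf (inside  ∷ S , e) = ext refl
    gf (outside ∷ S , e) = refl

  nC0≡1 : ∀ n → n C 0 ≡ 1
  nC0≡1 n = trans (nCk≡nC[n∸k] {0} {n} z≤n) (nCn≡1 n)

kSubset-size : ∀ v k → HasSize (KSubset v k) (v C k)
kSubset-size zero    zero    = mk↔ₛ′ (λ _ → Fin.zero) (λ _ → [] , refl)
                                 (λ { Fin.zero → refl ; (Fin.suc ()) }) (λ { ([] , refl) → refl })
kSubset-size zero    (suc k) = mk↔ₛ′ (λ { ([] , ()) }) (λ ()) (λ ()) (λ { ([] , ()) })
kSubset-size (suc v) zero    = subst (HasSize _) (trans (nC0≡1 v) (sym (nC0≡1 (suc v))))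
                                 (kSubset-size v zero ↔-∘ splitZero)
kSubset-size (suc v) (suc k) = subst (HasSize _) (nCk+nC[k+1]≡[n+1]C[k+1] v k)
  (↔-sym +↔⊎ ↔-∘ ((kSubset-size v k ⊎-↔ kSubset-size v (suc k)) ↔-∘ splitSuc))

complete : ℕ → ℕ → Design
complete v k = record
  { Point        = Fin v
  ; Block        = KSubset v k
  ; _I_          = λ p B → p ∈ₛ proj₁ B
  ; I-irrelevant = []=-irrelevant
  ; point-finite = v , ↔-id (Fin v)
  ; block-finite = v C k , kSubset-size v k
  }

IsGroupIsomorphism : (G H : Group 0ℓ 0ℓ) → (Group.Carrier G → Group.Carrier H) → Set
IsGroupIsomorphism G H =
  GroupMorphisms.IsGroupIsomorphism (Group.rawGroup G) (Group.rawGroup H)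

{-# OPTIONS --safe #-}

-- Every permutation of the points acts on k-subsets, so the automorphism group
-- of C_{v,k} is the whole symmetric group.  If 2 < k < v ∸ 1 there are distinct
-- intersecting blocks A, B, C with ∣ A ─ B ∣ = 2 and ∣ A ─ C ∣ = 1, so no
-- automorphism takes (A , B) to (A , C).  For k = v ∸ 1 a block is determined by
-- the point it misses, and all orbit questions reduce to pairs of distinct
-- points; for k = 2 they reduce to tuples of at most four distinct points, on
-- which the symmetric group is transitive.
module Submission where

open import Data.Empty using (⊥-elim)
open import Data.Fin.Base using (Fin; zero; suc; fromℕ<)
open import Data.Fin.Patterns using (0F; 1F; 2F)
open import Data.Fin.Permutation using (transpose; ↔⇒≡)
open import Data.Fin.Properties using (_≟_)
open import Data.Fin.Subset using (Subset; ∣_∣; inside; outside; _∈_; _∉_; _⊆_; ⊥; ∁)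
open import Data.Fin.Subset.Properties using (_∈?_; ⊆-antisym; ∈⊤; ∣⊥∣≡0; ∣p∣≡n⇒p≡⊤; ∣∁p∣≡n∸∣p∣; x∈∁p⇒x∉p; x∉p⇒x∈∁p)
open import Data.Nat.Base using (ℕ; zero; suc; _+_; _∸_; _≤_; _<_; _≥_; s≤s)
open import Data.Nat.Combinatorics using (nCk≡nC[n∸k]; nC1≡n) renaming (_C_ to _choose_)
open import Data.Nat.Properties using (≡-irrelevant; suc-injective; m≤n⇒∃[o]m+o≡n; m+n∸n≡m; +-identityʳ; +-comm; +-suc; n≤1+n; m≤n⇒m≤1+n; n<1+n; <⇒≤; <-irrefl)
open import Data.Product.Base using (∃; _×_; _,_; proj₁; proj₂)
open import Data.Product.Function.Dependent.Propositional using (Σ-↔)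
open import Data.Sum.Base using (_⊎_; inj₁; inj₂)
open import Data.Vec.Base using (Vec; []; _∷_; here; there; map; tabulate; lookup)
open import Data.Vec.Properties using (map-∘; lookup∘tabulate; []=⇒lookup; lookup⇒[]=)
open import Data.Vec.Properties.WithK using ([]=-irrelevant)
open import Data.Vec.Relation.Unary.All as All using (All; []; _∷_)
open import Data.Vec.Relation.Unary.All.Properties using (map⁺)
open import Data.Vec.Relation.Unary.AllPairs using ([]; _∷_)
open import Data.Vec.Relation.Unary.Unique.Propositional using (Unique)
open import Function.Base using (_∘_)
open import Function.Bundles using (_⇔_; _↔_; Inverse; Equivalence; mk⇔; mk↔ₛ′)
open import Function.Construct.Composition using (_↔-∘_)
open import Function.Construct.Identity using (↔-id)
open import Function.Construct.Symmetry using (↔-sym)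
open import Relation.Binary.PropositionalEquality using (_≡_; _≢_; refl; sym; trans; cong; cong₂; subst; ≢-sym)
open import Relation.Nullary using (¬_; yes; no; contradiction)
import Relation.Nullary as Nullary
open import Relation.Nullary.Decidable using (dec-true; dec-false)
open import Relation.Unary using (Irrelevant)
open import Defs

open Inverse using (to; from; strictlyInverseˡ; strictlyInverseʳ)
open Automorphism using (actP; actB; onBlocks; preserves)

-- Bijections and subtypes

to-injective : ∀ {A B : Set} (σ : A ↔ B) {x y} → to σ x ≡ to σ y → x ≡ y
to-injective σ {x} {y} e =
  trans (sym (strictlyInverseʳ σ x)) (trans (cong (from σ) e) (strictlyInverseʳ σ y))

-- When both predicates are proof-irrelevant, a logical equivalence along `σ` is already a bijection
-- of fibres, so sizes of subtypes can be transported without comparing proofs.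
∃-↔ : ∀ {A B : Set} {P : A → Set} {Q : B → Set} → Irrelevant P → Irrelevant Q →
      (σ : A ↔ B) → (∀ a → P a ⇔ Q (to σ a)) → ∃ P ↔ ∃ Q
∃-↔ P-irr Q-irr σ P⇔Q = Σ-↔ σ (λ {a} →
  mk↔ₛ′ (Equivalence.to (P⇔Q a)) (Equivalence.from (P⇔Q a)) (λ _ → Q-irr _ _) (λ _ → P-irr _ _))

×-irrelevant : ∀ {A B : Set} → Nullary.Irrelevant A → Nullary.Irrelevant B →
               Nullary.Irrelevant (A × B)
×-irrelevant A-irr B-irr (a , b) (a′ , b′) = cong₂ _,_ (A-irr a a′) (B-irr b b′)

-- Subsets of a finite set

subset-size : ∀ {n} (S : Subset n) → HasSize (∃ λ p → p ∈ S) ∣ S ∣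
subset-size []            = mk↔ₛ′ (λ ()) (λ ()) (λ ()) (λ ())
subset-size (outside ∷ S) = subset-size S ↔-∘
  mk↔ₛ′ (λ { (suc p , there i) → p , i }) (λ (p , i) → suc p , there i)
        (λ _ → refl) (λ { (suc p , there i) → refl })
subset-size (inside ∷ S)  = mk↔ₛ′ f g fg gf
  where
  IH = subset-size S
  f : (∃ λ p → p ∈ inside ∷ S) → Fin (suc ∣ S ∣)
  f (zero  , here)    = zero
  f (suc p , there i) = suc (to IH (p , i))
  g : Fin (suc ∣ S ∣) → ∃ λ p → p ∈ inside ∷ S
  g zero    = zero , here
  g (suc j) = let p , i = from IH j in suc p , there i
  fg : ∀ j → f (g j) ≡ j
  fg zero    = refl
  fg (suc j) = cong suc (strictlyInverseˡ IH j)
  gf : ∀ x → g (f x) ≡ x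
  gf (zero  , here)    = refl
  gf (suc p , there i) = cong (λ (q , j) → suc q , there j) (strictlyInverseʳ IH (p , i))

kSubset-points : ∀ {v k} (B : KSubset v k) → HasSize (∃ λ p → p ∈ proj₁ B) k
kSubset-points (S , refl) = subset-size S

kSubset-ext : ∀ {v k} {B C : KSubset v k} →
              proj₁ B ⊆ proj₁ C → proj₁ C ⊆ proj₁ B → B ≡ C
kSubset-ext {B = S , d} {C = T , e} S⊆T T⊆S with ⊆-antisym S⊆T T⊆S
... | refl = cong (S ,_) (≡-irrelevant d e)

-- Any witness would do: it pads the blocks of the counterexample in the intermediate range, and it
-- supplies a block whose size can be read off.
initial : ∀ k m → KSubset (k + m) k
initial zero    m = ⊥ , ∣⊥∣≡0 m
initial (suc k) m = let S , e = initial k m in inside ∷ S , cong suc e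

-- Tabulated through the inverse of `σ`, so that membership of `q` is read off at its preimage.
image : ∀ {n} → Fin n ↔ Fin n → Subset n → Subset n
image σ S = tabulate (λ q → lookup S (from σ q))

∈-image⁻ : ∀ {n} (σ : Fin n ↔ Fin n) {S q} → q ∈ image σ S → from σ q ∈ S
∈-image⁻ σ {S} {q} i =
  lookup⇒[]= (from σ q) S (trans (sym (lookup∘tabulate _ q)) ([]=⇒lookup i))

∈-image⁺ : ∀ {n} (σ : Fin n ↔ Fin n) {S q} → from σ q ∈ S → q ∈ image σ S
∈-image⁺ σ {S} {q} i =
  lookup⇒[]= q (image σ S) (trans (lookup∘tabulate _ q) ([]=⇒lookup i))

∈-image : ∀ {n} (σ : Fin n ↔ Fin n) S p → p ∈ S ⇔ to σ p ∈ image σ S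
∈-image σ S p = mk⇔
  (λ i → ∈-image⁺ σ (subst (_∈ S) (sym (strictlyInverseʳ σ p)) i))
  (λ i → subst (_∈ S) (strictlyInverseʳ σ p) (∈-image⁻ σ i))

-- `σ` restricts to a bijection between the members of `S` and those of its image, and finite types
-- in bijection have equal sizes.
∣image∣ : ∀ {n} (σ : Fin n ↔ Fin n) S → ∣ image σ S ∣ ≡ ∣ S ∣
∣image∣ σ S = sym (↔⇒≡ (subset-size (image σ S) ↔-∘
  (∃-↔ []=-irrelevant []=-irrelevant σ (∈-image σ S) ↔-∘ ↔-sym (subset-size S))))

imageᵏ : ∀ {v k} → Fin v ↔ Fin v → KSubset v k → KSubset v k
imageᵏ σ (S , e) = image σ S , trans (∣image∣ σ S) e

-- Automorphisms of the complete design

fromPermutation : ∀ {v k} → Fin v ↔ Fin v → Automorphism (complete v k)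
fromPermutation σ = record
  { onPoints  = σ
  ; onBlocks  = mk↔ₛ′ (imageᵏ σ) (imageᵏ (↔-sym σ))
      (λ B → kSubset-ext
        (λ i → subst (_∈ proj₁ B) (strictlyInverseˡ σ _) (∈-image⁻ (↔-sym σ) (∈-image⁻ σ i)))
        (λ i → ∈-image⁺ σ (∈-image⁺ (↔-sym σ) (subst (_∈ proj₁ B) (sym (strictlyInverseˡ σ _)) i))))
      (λ B → kSubset-ext
        (λ i → subst (_∈ proj₁ B) (strictlyInverseʳ σ _) (∈-image⁻ σ (∈-image⁻ (↔-sym σ) i)))
        (λ i → ∈-image⁺ (↔-sym σ) (∈-image⁺ σ (subst (_∈ proj₁ B) (sym (strictlyInverseʳ σ _)) i))))
  ; preserves = λ p B → ∈-image σ (proj₁ B) p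
  }

module _ {v k} (α : Automorphism (complete v k)) where

  act-∈ : ∀ B {p q} → actP α p ≡ q → p ∈ proj₁ B → q ∈ proj₁ (actB α B)
  act-∈ _ refl = Equivalence.to (preserves α _ _)

  act-∉ : ∀ B {p q} → actP α p ≡ q → p ∉ proj₁ B → q ∉ proj₁ (actB α B)
  act-∉ _ refl p∉B = p∉B ∘ Equivalence.from (preserves α _ _)

-- Each point of the image of `B` comes from a point of `B`, where the two actions agree. Used in
-- both directions, this shows that the action on points is faithful.
actB-⊆ : ∀ {v k} (α β : Automorphism (complete v k)) →
         (∀ p → actP α p ≡ actP β p) → ∀ B → proj₁ (actB α B) ⊆ proj₁ (actB β B)
actB-⊆ α β α≈β B {q} i =
  act-∈ β B (trans (sym (α≈β p)) αp≡q)
    (Equivalence.from (preserves α p B) (subst (_∈ proj₁ (actB α B)) (sym αp≡q) i))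
  where
  p = from (onPoints α) q
  αp≡q = strictlyInverseˡ (onPoints α) q

onPoints-isomorphism : ∀ v k → IsGroupIsomorphism (Aut (complete v k)) (Sym (Fin v)) onPoints
onPoints-isomorphism v k = record
  { isGroupMonomorphism = record
    { isGroupHomomorphism = record
      { isMonoidHomomorphism = record
        { isMagmaHomomorphism = record
          { isRelHomomorphism = record { cong = proj₁ }
          ; homo              = λ _ _ _ → refl
          }
        ; ε-homo = λ _ → refl
        }
      ; ⁻¹-homo = λ _ _ → refl
      }
    ; injective = λ {α} {β} e →
        e , λ B → kSubset-ext (actB-⊆ α β e B) (actB-⊆ β α (sym ∘ e) B)
    }
  ; surjective = λ σ → fromPermutation σ , proj₁
  }

-- Multiple transitivity of the symmetric group

transpose-fix : ∀ {n} {i j k : Fin n} → k ≢ i → k ≢ j → to (transpose i j) k ≡ k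
transpose-fix {i = i} {j} {k} k≢i k≢j
  rewrite dec-false (k ≟ i) k≢i | dec-false (k ≟ j) k≢j = refl

transpose-fst : ∀ {n} (i j : Fin n) → to (transpose i j) i ≡ j
transpose-fst i j rewrite dec-true (i ≟ i) refl = refl

-- Induction on the length: once `σ` carries the tail of `xs` to the tail of `ys`, the transposition
-- of `to σ x` and `y` corrects the head. It fixes the tail, which contains neither of these two
-- points.
Sym-multiplyTransitive : ∀ {n v} {xs ys : Vec (Fin v) n} → Unique xs → Unique ys →
                         ∃ λ (σ : Fin v ↔ Fin v) → map (to σ) xs ≡ ys
Sym-multiplyTransitive {xs = []}     {[]}     []           []           = ↔-id _ , refl
Sym-multiplyTransitive {xs = x ∷ xs} {y ∷ ys} (x∉xs ∷ xs!) (y∉ys ∷ ys!)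
  with σ , refl ← Sym-multiplyTransitive xs! ys! =
  τ ↔-∘ σ ,
  cong₂ _∷_ (transpose-fst (to σ x) y)
    (trans (map-∘ (to τ) (to σ) xs) (τ-fixes _ σx∉ys y∉ys))
  where
  τ = transpose (to σ x) y
  σx∉ys : All (to σ x ≢_) (map (to σ) xs)
  σx∉ys = map⁺ (All.map (λ x≢z → x≢z ∘ to-injective σ) x∉xs)
  τ-fixes : ∀ {m} (zs : Vec _ m) → All (to σ x ≢_) zs → All (y ≢_) zs → map (to τ) zs ≡ zs
  τ-fixes []       []       []       = refl
  τ-fixes (z ∷ zs) (p ∷ ps) (q ∷ qs) =
    cong₂ _∷_ (transpose-fix (≢-sym p) (≢-sym q)) (τ-fixes zs ps qs)

fullAut : ∀ v k → Subgroup (Aut (complete v k))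
fullAut v k = viaPoints (complete v k) (whole (Sym (Fin v)))

fullAut-twoTransitive : ∀ v k → TwoTransitive (complete v k) (fullAut v k)
fullAut-twoTransitive v k p≢q p′≢q′
  with σ , refl ← Sym-multiplyTransitive ((p≢q ∷ []) ∷ [] ∷ []) ((p′≢q′ ∷ []) ∷ [] ∷ []) =
  fromPermutation σ , _ , refl , refl

-- The complete design as a 2-design

blocksThrough₀₁ : ∀ v k → HasSize (∃ λ (B : KSubset (2 + v) (2 + k)) → 0F ∈ proj₁ B × 1F ∈ proj₁ B) (v choose k)
blocksThrough₀₁ v k = kSubset-size v k ↔-∘ mk↔ₛ′
  -- Deleting the points 0 and 1 leaves an arbitrary `k`-subset of the other `v` points.
  (λ { ((_ ∷ _ ∷ S , e) , here , there here) → S , suc-injective (suc-injective e) })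
  (λ (S , e) → (inside ∷ inside ∷ S , cong (2 +_) e) , here , there here)
  (λ (S , e) → cong (S ,_) (≡-irrelevant _ _))
  (λ { ((_ ∷ _ ∷ S , e) , here , there here) →
       cong (λ d → (inside ∷ inside ∷ S , d) , here , there here) (≡-irrelevant _ _) })

complete-2-design : ∀ v k → Is2-vkλ-Design (complete (2 + v) (2 + k)) (2 + v) (2 + k) (v choose k)
complete-2-design v k = record
  { points     = ↔-id _
  ; blockSize  = kSubset-points
  ; pairDegree = pairDegree
  }
  where
  pairDegree : ∀ p q → p ≢ q →
               HasSize (∃ λ (B : KSubset (2 + v) (2 + k)) → p ∈ proj₁ B × q ∈ proj₁ B) (v choose k)
  pairDegree p q p≢q
    -- An automorphism taking `(p , q)` to `(0 , 1)` maps the blocks through `p` and `q` bijectively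
    -- to those through 0 and 1, so one count settles all pairs.
    with α , _ , αp≡0 , αq≡1 ← fullAut-twoTransitive (2 + v) (2 + k) {x′ = 0F} {y′ = 1F} p≢q (λ ()) =
    blocksThrough₀₁ v k ↔-∘
    ∃-↔ (×-irrelevant []=-irrelevant []=-irrelevant) (×-irrelevant []=-irrelevant []=-irrelevant)
        (onBlocks α)
        (λ B → mk⇔
          (λ (i , j) → act-∈ α B αp≡0 i , act-∈ α B αq≡1 j)
          (λ (i , j) → Equivalence.from (preserves α p B) (subst (_∈ proj₁ (actB α B)) (sym αp≡0) i) ,
                       Equivalence.from (preserves α q B) (subst (_∈ proj₁ (actB α B)) (sym αq≡1) j)))

complete-is2-vkλ : ∀ {v k} → 1 < k → k ≤ v → ∃ (Is2-vkλ-Design (complete v k) v k)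
complete-is2-vkλ {suc (suc v)} {suc (suc k)} (s≤s (s≤s _)) (s≤s (s≤s _)) = _ , complete-2-design v k

-- The intermediate range 2 < k < v ∸ 1

intermediate-not-transitive : ∀ j m (G : Subgroup (Aut (complete (5 + (j + m)) (3 + j)))) →
                              ¬ PairwiseTransitive (complete (5 + (j + m)) (3 + j)) G
intermediate-not-transitive j m G pt =
  -- The points 1 and 2 lie in `A` but not in `B`. Their images lie in `A` but not in `C`, which
  -- leaves only the point 1 for both, against injectivity.
  1≢2 (to-injective (onPoints α) (trans
    (α-image (there here) λ { (there ()) })
    (sym (α-image (there (there here)) λ { (there (there ())) }))))
  where
  X = proj₁ (initial j m)
  e = proj₂ (initial j m)
  A B C : KSubset (5 + (j + m)) (3 + j)
  -- The blocks are {0,1,2}, {0,3,4} and {0,2,3}, each enlarged by the same `j` points `X`; the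
  -- point 0 makes both pairs intersecting.
  A = inside ∷ inside  ∷ inside  ∷ outside ∷ outside ∷ X , cong (3 +_) e
  B = inside ∷ outside ∷ outside ∷ inside  ∷ inside  ∷ X , cong (3 +_) e
  C = inside ∷ outside ∷ inside  ∷ inside  ∷ outside ∷ X , cong (3 +_) e
  A≢B : A ≢ B
  A≢B ()
  A≢C : A ≢ C
  A≢C ()
  1≢2 : _≢_ {A = Fin (5 + (j + m))} 1F 2F
  1≢2 ()
  move = PairwiseTransitive.distinctIntersecting pt (A≢B , 0F , here , here) (A≢C , 0F , here , here)
  α = proj₁ move
  αA≡A = proj₁ (proj₂ (proj₂ move))
  αB≡C = proj₂ (proj₂ (proj₂ move))
  A─C : ∀ {p} → p ∈ proj₁ A → p ∉ proj₁ C → p ≡ 1F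
  A─C here                                i∉C = contradiction here i∉C
  A─C (there here)                        i∉C = refl
  A─C (there (there here))                i∉C = contradiction (there (there here)) i∉C
  A─C (there (there (there (there (there i))))) i∉C =
    contradiction (there (there (there (there (there i))))) i∉C
  α-image : ∀ {p} → p ∈ proj₁ A → p ∉ proj₁ B → actP α p ≡ 1F
  α-image p∈A p∉B = A─C
    (subst (λ D → actP α _ ∈ proj₁ D) αA≡A (act-∈ α A refl p∈A))
    (subst (λ D → actP α _ ∉ proj₁ D) αB≡C (act-∉ α B refl p∉B))

-- Case division by block size

data BlockSizeCase : ℕ → ℕ → Set where
  two          : ∀ {v} → BlockSizeCase v 2
  full         : ∀ {v} → BlockSizeCase v v
  copoint      : ∀ {k} → BlockSizeCase (suc k) k
  -- Here `k` is `3 + j` and `v` is `k + (2 + m)`, which encodes 2 < `k` < `v ∸ 1`.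
  intermediate : ∀ j m → BlockSizeCase (5 + (j + m)) (3 + j)

blockSizeCase : ∀ {v k} → 1 < k → k ≤ v → BlockSizeCase v k
blockSizeCase {k = 2}               _ _   = two
blockSizeCase {k = suc (suc (suc j))} (s≤s (s≤s _)) k≤v with m≤n⇒∃[o]m+o≡n k≤v
-- The split is on the difference of `v` and `k`: 0, 1, or at least 2. The rewrites bring the sum
-- into the shape of the constructor's indices.
... | 0 , refl rewrite +-identityʳ j = full
... | 1 , refl rewrite +-comm j 1 = copoint
... | suc (suc m) , refl rewrite +-suc j (suc m) | +-suc j m = intermediate j m
blockSizeCase {k = 1} (s≤s ()) _

-- Blocks with one point missing

copoint-size : ∀ {k} (B : KSubset (suc k) k) → HasSize (∃ λ p → p ∈ ∁ (proj₁ B)) 1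
copoint-size {k} (S , e) = subst (HasSize _)
  (trans (∣∁p∣≡n∸∣p∣ S) (trans (cong (suc k ∸_) e) (m+n∸n≡m 1 k)))
  (subset-size (∁ S))

missed : ∀ {k} (B : KSubset (suc k) k) → ∃ λ q → q ∉ proj₁ B
missed B = let q , i = from (copoint-size B) 0F in q , x∈∁p⇒x∉p i

missed-unique : ∀ {k} (B : KSubset (suc k) k) {p q} → p ∉ proj₁ B → q ∉ proj₁ B → p ≡ q
missed-unique B p∉B q∉B =
  cong proj₁ (to-injective (copoint-size B) {_ , x∉p⇒x∈∁p p∉B} {_ , x∉p⇒x∈∁p q∉B} (Fin1-≡ _ _))
  where
  Fin1-≡ : (i j : Fin 1) → i ≡ j
  Fin1-≡ 0F 0F = refl

copoint-∈ : ∀ {k} (B : KSubset (suc k) k) {p q} → q ∉ proj₁ B → p ≢ q → p ∈ proj₁ B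
copoint-∈ B {p} q∉B p≢q with p ∈? proj₁ B
... | yes p∈B = p∈B
... | no  p∉B = contradiction (missed-unique B p∉B q∉B) p≢q

-- Both blocks contain every point other than `q`.
copoint-≡ : ∀ {k} {B C : KSubset (suc k) k} {q} → q ∉ proj₁ B → q ∉ proj₁ C → B ≡ C
copoint-≡ {B = B} {C} q∉B q∉C = kSubset-ext
  (λ i → copoint-∈ C q∉C λ { refl → q∉B i })
  (λ i → copoint-∈ B q∉B λ { refl → q∉C i })

-- Provides a common point of the block missing `p` and the block missing `q`, so that any two
-- copoint blocks intersect.
∃≢≢ : ∀ {n} → 3 ≤ n → (p q : Fin n) → ∃ λ r → r ≢ p × r ≢ q
∃≢≢ (s≤s (s≤s (s≤s _))) 0F            0F            = 1F , (λ ()) , λ ()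
∃≢≢ (s≤s (s≤s (s≤s _))) 0F            1F            = 2F , (λ ()) , λ ()
∃≢≢ (s≤s (s≤s (s≤s _))) 0F            (suc (suc _)) = 1F , (λ ()) , λ ()
∃≢≢ (s≤s (s≤s (s≤s _))) 1F            0F            = 2F , (λ ()) , λ ()
∃≢≢ (s≤s (s≤s (s≤s _))) (suc (suc _)) 0F            = 1F , (λ ()) , λ ()
∃≢≢ (s≤s (s≤s (s≤s _))) (suc _)       (suc _)       = 0F , (λ ()) , λ ()

∃≢ : ∀ {n} → 2 ≤ n → (p : Fin n) → ∃ λ q → p ≢ q
∃≢ (s≤s (s≤s _)) 0F      = 1F , λ ()
∃≢ (s≤s (s≤s _)) (suc _) = 0F , λ ()

-- Replacing each block by its missed point turns an incident pair, or a pair of distinct blocks,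
-- into a pair of distinct points. In a non-incident pair the point itself determines the block, and
-- no two blocks are disjoint.
copoint-pairwiseTransitive : ∀ {k} → 2 ≤ k → (G : Subgroup (Aut (complete (suc k) k))) →
  TwoTransitive (complete (suc k) k) G → PairwiseTransitive (complete (suc k) k) G
copoint-pairwiseTransitive {k} 2≤k G 2-trans = record
  { distinctPoints       = 2-trans
  ; incident             = incident
  ; nonIncident          = nonIncident
  ; distinctIntersecting = λ (B≢C , _) (B′≢C′ , _) → distinct B≢C B′≢C′
  ; nonIntersecting      = λ {B} {C} ¬BC _ → contradiction (intersecting B C) ¬BC
  }
  where
  D = complete (suc k) k
  incident : TransitiveOnPairs D G actP actB (λ p B → p ∈ proj₁ B)
  incident {p} {B} {p′} {B′} i i′ =
    let q , q∉B = missed B ; q′ , q′∉B′ = missed B′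
        α , α∈G , αp , αq = 2-trans {p} {q} {p′} {q′} (λ { refl → q∉B i }) (λ { refl → q′∉B′ i′ })
    in α , α∈G , αp , copoint-≡ (act-∉ α B αq q∉B) q′∉B′
  nonIncident : TransitiveOnPairs D G actP actB (λ p B → p ∉ proj₁ B)
  nonIncident {p} {B} {p′} {B′} p∉B p′∉B′ =
    -- Only the images of `p` and `p′` matter; `q` and `q′` are arbitrary partners that allow
    -- 2-transitivity to be applied.
    let q , p≢q = ∃≢ (m≤n⇒m≤1+n 2≤k) p ; q′ , p′≢q′ = ∃≢ (m≤n⇒m≤1+n 2≤k) p′
        α , α∈G , αp , _ = 2-trans p≢q p′≢q′
    in α , α∈G , αp , copoint-≡ (act-∉ α B αp p∉B) p′∉B′
  distinct : TransitiveOnPairs D G actB actB (λ B C → B ≢ C)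
  distinct {B} {C} {B′} {C′} B≢C B′≢C′ =
    let p , p∉B = missed B ; p′ , p′∉B′ = missed B′
        q , q∉C = missed C ; q′ , q′∉C′ = missed C′
        α , α∈G , αp , αq = 2-trans {p} {q} {p′} {q′}
          (λ p≡q → B≢C (copoint-≡ (subst (_∉ proj₁ B) p≡q p∉B) q∉C))
          (λ p′≡q′ → B′≢C′ (copoint-≡ (subst (_∉ proj₁ B′) p′≡q′ p′∉B′) q′∉C′))
    in α , α∈G , copoint-≡ (act-∉ α B αp p∉B) p′∉B′ , copoint-≡ (act-∉ α C αq q∉C) q′∉C′
  intersecting : ∀ B C → Intersecting D B C
  intersecting B C =
    let p , p∉B = missed B ; q , q∉C = missed C ; r , r≢p , r≢q = ∃≢≢ (s≤s 2≤k) p q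
    in r , copoint-∈ B p∉B r≢p , copoint-∈ C q∉C r≢q

-- Blocks containing all points

full-∈ : ∀ {v} (B : KSubset v v) p → p ∈ proj₁ B
full-∈ (S , e) p = subst (p ∈_) (sym (∣p∣≡n⇒p≡⊤ e)) ∈⊤

full-≡ : ∀ {v} (B C : KSubset v v) → B ≡ C
full-≡ B C = kSubset-ext (λ _ → full-∈ C _) (λ _ → full-∈ B _)

-- With a single block containing every point, incident pairs reduce to points, and the last three
-- sets of pairs are empty.
full-pairwiseTransitive : ∀ {v} → 2 ≤ v → PairwiseTransitive (complete v v) (fullAut v v)
full-pairwiseTransitive {v} 2≤v = record
  { distinctPoints       = fullAut-twoTransitive v v
  ; incident             = λ {p} {B} {p′} {B′} _ _ →
      let α , α∈G , αp , _ = fullAut-twoTransitive v v (proj₂ (∃≢ 2≤v p)) (proj₂ (∃≢ 2≤v p′))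
      in α , α∈G , αp , full-≡ _ _
  ; nonIncident          = λ {p} {B} p∉B _ → contradiction (full-∈ B p) p∉B
  ; distinctIntersecting = λ {B} {C} (B≢C , _) _ → contradiction (full-≡ B C) B≢C
  ; nonIntersecting      = λ {B} {C} ¬BC _ →
      let p , _ = from (kSubset-points B) (fromℕ< 2≤v)
      in contradiction (p , full-∈ B p , full-∈ C p) ¬BC
  }

-- Blocks of size two

other : ∀ {v} (B : KSubset v 2) {a} → a ∈ proj₁ B →
        ∃ λ b → a ≢ b × b ∈ proj₁ B × (∀ {p} → p ∈ proj₁ B → p ≡ a ⊎ p ≡ b)
other B {a} a∈B = proj₁ b , a≢b , proj₂ b , covers
  where
  size = kSubset-points B
  -- The second point of `B` is found by swapping the two indices in the enumeration of `B` by
  -- `Fin 2`.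
  flip : Fin 2 → Fin 2
  flip 0F = 1F
  flip 1F = 0F
  flip-≢ : ∀ i → i ≢ flip i
  flip-≢ 0F ()
  flip-≢ 1F ()
  flip-covers : ∀ i j → j ≡ i ⊎ j ≡ flip i
  flip-covers 0F 0F = inj₁ refl
  flip-covers 0F 1F = inj₂ refl
  flip-covers 1F 0F = inj₂ refl
  flip-covers 1F 1F = inj₁ refl
  i = to size (a , a∈B)
  b = from size (flip i)
  a≢b : a ≢ proj₁ b
  a≢b a≡b = flip-≢ i (trans (cong (to size) (pair-≡ a≡b a∈B (proj₂ b))) (strictlyInverseˡ size (flip i)))
    where
    pair-≡ : ∀ {S : Subset _} {x y} → x ≡ y → (d : x ∈ S) (e : y ∈ S) → (x , d) ≡ (y , e)
    pair-≡ refl d e = cong (_ ,_) ([]=-irrelevant d e)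
  covers : ∀ {p} → p ∈ proj₁ B → p ≡ a ⊎ p ≡ proj₁ b
  covers {p} p∈B with flip-covers i (to size (p , p∈B))
  ... | inj₁ e = inj₁ (cong proj₁ (to-injective size e))
  ... | inj₂ e = inj₂ (cong proj₁ (trans (sym (strictlyInverseʳ size (p , p∈B))) (cong (from size) e)))

-- The point that `other` pairs with `a` must be `b`, so every point of `B` is `a` or `b`, and both
-- lie in `C`.
duad-⊆ : ∀ {v} (B C : KSubset v 2) {a b} → a ≢ b → a ∈ proj₁ B → b ∈ proj₁ B →
         a ∈ proj₁ C → b ∈ proj₁ C → proj₁ B ⊆ proj₁ C
duad-⊆ B C a≢b a∈B b∈B a∈C b∈C p∈B with other B a∈B
... | _ , _ , _ , covers with covers b∈B | covers p∈B
...   | inj₁ refl | _         = contradiction refl a≢b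
...   | inj₂ refl | inj₁ refl = a∈C
...   | inj₂ refl | inj₂ refl = b∈C

duad-≡ : ∀ {v} {B C : KSubset v 2} {a b} → a ≢ b → a ∈ proj₁ B → b ∈ proj₁ B →
         a ∈ proj₁ C → b ∈ proj₁ C → B ≡ C
duad-≡ {B = B} {C} a≢b a∈B b∈B a∈C b∈C = kSubset-ext
  (duad-⊆ B C a≢b a∈B b∈B a∈C b∈C) (duad-⊆ C B a≢b a∈C b∈C a∈B b∈B)

elements : ∀ {v} (B : KSubset v 2) → ∃ λ a → ∃ λ b → a ≢ b × a ∈ proj₁ B × b ∈ proj₁ B
elements B =
  let a , a∈B = from (kSubset-points B) 0F ; b , a≢b , b∈B , _ = other B a∈B
  in a , b , a≢b , a∈B , b∈B

∈∉⇒≢ : ∀ {n} {S : Subset n} {p q} → p ∈ S → q ∉ S → q ≢ p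
∈∉⇒≢ p∈S q∉S refl = q∉S p∈S

-- Each pair is encoded by a tuple of distinct points: two for an incident pair, three for a
-- non-incident pair or for two blocks meeting in a point, four for disjoint blocks. A permutation
-- matching the tuples matches the blocks, since two points determine a duad.
duad-pairwiseTransitive : ∀ v → PairwiseTransitive (complete v 2) (fullAut v 2)
duad-pairwiseTransitive v = record
  { distinctPoints       = fullAut-twoTransitive v 2
  ; incident             = incident
  ; nonIncident          = nonIncident
  ; distinctIntersecting = distinctIntersecting
  ; nonIntersecting      = nonIntersecting
  }
  where
  D = complete v 2
  G = fullAut v 2
  incident : TransitiveOnPairs D G actP actB (λ p B → p ∈ proj₁ B)
  incident {y = B} {y′ = B′} i i′
    with b , a≢b , b∈B , _ ← other B i | b′ , a′≢b′ , b′∈B′ , _ ← other B′ i′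
    with α , α∈G , refl , refl ← fullAut-twoTransitive v 2 a≢b a′≢b′ =
    α , α∈G , refl , duad-≡ a′≢b′ (act-∈ α B refl i) (act-∈ α B refl b∈B) i′ b′∈B′
  nonIncident : TransitiveOnPairs D G actP actB (λ p B → p ∉ proj₁ B)
  nonIncident {y = B} {y′ = B′} c∉B c′∉B′
    with a , b , a≢b , a∈B , b∈B ← elements B | a′ , b′ , a′≢b′ , a′∈B′ , b′∈B′ ← elements B′
    with σ , refl ← Sym-multiplyTransitive
      ((∈∉⇒≢ a∈B c∉B ∷ ∈∉⇒≢ b∈B c∉B ∷ []) ∷ (a≢b ∷ []) ∷ [] ∷ [])
      ((∈∉⇒≢ a′∈B′ c′∉B′ ∷ ∈∉⇒≢ b′∈B′ c′∉B′ ∷ []) ∷ (a′≢b′ ∷ []) ∷ [] ∷ []) =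
    let α = fromPermutation σ
    in α , _ , refl , duad-≡ a′≢b′ (act-∈ α B refl a∈B) (act-∈ α B refl b∈B) a′∈B′ b′∈B′
  distinctIntersecting : TransitiveOnPairs D G actB actB (λ B C → B ≢ C × Intersecting D B C)
  distinctIntersecting {B} {C} {B′} {C′} (B≢C , a , a∈B , a∈C) (B′≢C′ , a′ , a′∈B′ , a′∈C′)
    with b , a≢b , b∈B , _ ← other B a∈B | b′ , a′≢b′ , b′∈B′ , _ ← other B′ a′∈B′
       | c , a≢c , c∈C , _ ← other C a∈C | c′ , a′≢c′ , c′∈C′ , _ ← other C′ a′∈C′
    with σ , refl ← Sym-multiplyTransitive
      ((a≢b ∷ a≢c ∷ []) ∷
       -- If the second points of `B` and `C` coincided, the two blocks would share two points and
       -- be equal.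
       ((λ { refl → B≢C (duad-≡ a≢b a∈B b∈B a∈C c∈C) }) ∷ []) ∷ [] ∷ [])
      ((a′≢b′ ∷ a′≢c′ ∷ []) ∷
       ((λ { refl → B′≢C′ (duad-≡ a′≢b′ a′∈B′ b′∈B′ a′∈C′ c′∈C′) }) ∷ []) ∷ [] ∷ []) =
    let α = fromPermutation σ
    in α , _ , duad-≡ a′≢b′ (act-∈ α B refl a∈B) (act-∈ α B refl b∈B) a′∈B′ b′∈B′
             , duad-≡ a′≢c′ (act-∈ α C refl a∈C) (act-∈ α C refl c∈C) a′∈C′ c′∈C′
  disjoint-≢ : ∀ {B C p q} → ¬ Intersecting D B C → p ∈ proj₁ B → q ∈ proj₁ C → p ≢ q
  disjoint-≢ ¬BC p∈B q∈C refl = ¬BC (_ , p∈B , q∈C)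
  nonIntersecting : TransitiveOnPairs D G actB actB (λ B C → ¬ Intersecting D B C)
  nonIntersecting {B} {C} {B′} {C′} ¬BC ¬B′C′
    with a , b , a≢b , a∈B , b∈B ← elements B | a′ , b′ , a′≢b′ , a′∈B′ , b′∈B′ ← elements B′
       | c , d , c≢d , c∈C , d∈C ← elements C | c′ , d′ , c′≢d′ , c′∈C′ , d′∈C′ ← elements C′
    with σ , refl ← Sym-multiplyTransitive
      ((a≢b ∷ disjoint-≢ {B} {C} ¬BC a∈B c∈C ∷ disjoint-≢ {B} {C} ¬BC a∈B d∈C ∷ []) ∷
       (disjoint-≢ {B} {C} ¬BC b∈B c∈C ∷ disjoint-≢ {B} {C} ¬BC b∈B d∈C ∷ []) ∷ (c≢d ∷ []) ∷ [] ∷ [])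
      ((a′≢b′ ∷ disjoint-≢ {B′} {C′} ¬B′C′ a′∈B′ c′∈C′ ∷ disjoint-≢ {B′} {C′} ¬B′C′ a′∈B′ d′∈C′ ∷ []) ∷
       (disjoint-≢ {B′} {C′} ¬B′C′ b′∈B′ c′∈C′ ∷ disjoint-≢ {B′} {C′} ¬B′C′ b′∈B′ d′∈C′ ∷ []) ∷ (c′≢d′ ∷ []) ∷ [] ∷ []) =
    let α = fromPermutation σ
    in α , _ , duad-≡ a′≢b′ (act-∈ α B refl a∈B) (act-∈ α B refl b∈B) a′∈B′ b′∈B′
             , duad-≡ c′≢d′ (act-∈ α C refl c∈C) (act-∈ α C refl d∈C) c′∈C′ d′∈C′

-- Assembly of the equivalences

nonTrivial⇒2<k<v : ∀ {v k} → k ≤ v → IsNonTrivial2Design (complete v k) → 2 < k × k < v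
nonTrivial⇒2<k<v k≤v (v′ , k′ , _ , design , 2<k′ , k′<v′)
  -- The parameters in the non-triviality hypothesis are existentially quantified. Counting points
  -- identifies the first with `v`; counting the points of one actual block, available because
  -- `k ≤ v`, identifies the second with `k`.
  with m , refl ← m≤n⇒∃[o]m+o≡n k≤v
  with refl ← ↔⇒≡ (Is2-vkλ-Design.points design)
  with refl ← ↔⇒≡ (Is2-vkλ-Design.blockSize design (initial _ m) ↔-∘ ↔-sym (kSubset-points (initial _ m))) =
  2<k′ , k′<v′

-- Stated for an arbitrary `G`, so that it serves both the full symmetric group and the
-- classification of non-trivial cases.
pairwiseTransitive⇒ : ∀ {v k} → 1 < k → k ≤ v → (G : Subgroup (Aut (complete v k))) →
                      PairwiseTransitive (complete v k) G → k ≡ 2 ⊎ k ≡ v ∸ 1 ⊎ k ≡ v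
pairwiseTransitive⇒ 1<k k≤v G pt with blockSizeCase 1<k k≤v
... | two              = inj₁ refl
... | copoint          = inj₂ (inj₁ refl)
... | full             = inj₂ (inj₂ refl)
... | intermediate j m = ⊥-elim (intermediate-not-transitive j m G pt)

fullAut-pairwiseTransitive : ∀ {v k} → 1 < k → k ≤ v → k ≡ 2 ⊎ k ≡ v ∸ 1 ⊎ k ≡ v →
                             PairwiseTransitive (complete v k) (fullAut v k)
fullAut-pairwiseTransitive {v}     1<k k≤v (inj₁ refl)        = duad-pairwiseTransitive v
-- Truncated subtraction would make `k` equal to 0 here, which `1 < k` excludes.
fullAut-pairwiseTransitive {zero}  () k≤v (inj₂ (inj₁ refl))
fullAut-pairwiseTransitive {suc k} 1<k k≤v (inj₂ (inj₁ refl)) =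
  copoint-pairwiseTransitive 1<k (fullAut (suc k) k) (fullAut-twoTransitive (suc k) k)
fullAut-pairwiseTransitive         1<k k≤v (inj₂ (inj₂ refl)) = full-pairwiseTransitive 1<k

nonTrivial⇒copoint : ∀ {v k} → 1 < k → k ≤ v → (G : Subgroup (Aut (complete v k))) →
  IsNonTrivial2Design (complete v k) → PairwiseTransitive (complete v k) G →
  k ≡ v ∸ 1 × v ∸ 1 ≥ 3
nonTrivial⇒copoint 1<k k≤v G nt pt
  with 2<k , k<v ← nonTrivial⇒2<k<v k≤v nt
  with pairwiseTransitive⇒ 1<k k≤v G pt
-- Non-triviality rules out `k ≡ 2` by `2 < k`, and `k ≡ v` by `k < v`.
... | inj₁ refl        = contradiction 2<k (<-irrefl refl)
... | inj₂ (inj₁ refl) = refl , 2<k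
... | inj₂ (inj₂ refl) = contradiction k<v (<-irrefl refl)

copoint⇒nonTrivial : ∀ {v k} → (G : Subgroup (Aut (complete v k))) →
  k ≡ v ∸ 1 → v ∸ 1 ≥ 3 → TwoTransitive (complete v k) G →
  IsNonTrivial2Design (complete v k) × PairwiseTransitive (complete v k) G
copoint⇒nonTrivial {suc k} G refl 2<k 2-trans =
  (suc k , k , _ , proj₂ (complete-is2-vkλ 2≤k (n≤1+n k)) , 2<k , n<1+n k) ,
  copoint-pairwiseTransitive 2≤k G 2-trans
  where
  2≤k : 2 ≤ k
  2≤k = <⇒≤ 2<k

-- The number of blocks is the binomial coefficient of `1 + k` over `k`, which by symmetry is that
-- of `1 + k` over 1, the number of points.
copoint-symmetric : ∀ v → 1 < v ∸ 1 → IsSymmetric2Design (complete v (v ∸ 1))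
copoint-symmetric (suc k) 1<k =
  suc k , k , _ , proj₂ (complete-is2-vkλ 1<k (n≤1+n k)) ,
  subst (HasSize _) [1+k]Ck≡1+k (kSubset-size (suc k) k)
  where
  [1+k]Ck≡1+k : suc k choose k ≡ suc k
  [1+k]Ck≡1+k = trans (nCk≡nC[n∸k] (n≤1+n k))
    (trans (cong (suc k choose_) (m+n∸n≡m 1 k)) (nC1≡n (suc k)))

lemma2p6 : (v k : ℕ) → 1 < k → k ≤ v →
    IsGroupIsomorphism (Aut (complete v k)) (Sym (Fin v)) onPoints
    × ((Is2Design (complete v k) × PairwiseTransitive (complete v k) (viaPoints (complete v k) (whole (Sym (Fin v)))))
    ⇔ (k ≡ 2 ⊎ k ≡ v ∸ 1 ⊎ k ≡ v))
    × ((G : Subgroup (Aut (complete v k))) →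
    (IsNonTrivial2Design (complete v k) × PairwiseTransitive (complete v k) G)
    ⇔ ((k ≡ v ∸ 1 × v ∸ 1 ≥ 3) × TwoTransitive (complete v k) G))
    × (1 < v ∸ 1 → IsSymmetric2Design (complete v (v ∸ 1)))
lemma2p6 v k 1<k k≤v =
  onPoints-isomorphism v k ,
  mk⇔ (λ (_ , pt) → pairwiseTransitive⇒ 1<k k≤v (fullAut v k) pt)
      (λ c → (v , k , complete-is2-vkλ 1<k k≤v) , fullAut-pairwiseTransitive 1<k k≤v c) ,
  (λ G → mk⇔
    -- 2-transitivity of `G` is the first of the five conditions.
    (λ (nt , pt) → nonTrivial⇒copoint 1<k k≤v G nt pt , PairwiseTransitive.distinctPoints pt)
    (λ ((k≡v∸1 , v∸1≥3) , 2-trans) → copoint⇒nonTrivial G k≡v∸1 v∸1≥3 2-trans)) ,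
  copoint-symmetric v
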